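{- Let $D_{(<,>)}(x)$ be the generating function, with respect to the length, for the total number of descents over all Catalan words avoiding the ordered pair of relations $(<,>)$. Then $$D_{(<,>)}(x)=\frac{1 - 4 x + 3 x^2 -(1-2x) \sqrt{1 - 4 x + 2 x^2 + x^4}}{2 (1 - x) x\sqrt{1 - 4 x + 2 x^2 + x^4}}.$$
   Context: A Catalan word of length $n$ is a word $w=w_1w_2\cdots w_n$ over the non-negative integers with $w_1=0$ and $0\leq w_i\leq w_{i-1}+1$ for $i=2,\dots,n$; the empty word is the unique Catalan word of length $0$. For relations $X,Y\in\{<,>,\leq,\geq,=,\neq\}$, a word $w$ contains the pattern $(X,Y)$ if there is an index $i\geq 1$ (with $i+2\le n$) such that $w_i\,X\,w_{i+1}$ and $w_{i+1}\,Y\,w_{i+2}$; otherwise $w$ avoids $(X,Y)$. The number of descents $\mathrm{des}(w)$ is the number of indices $i$ with $w_i>w_{i+1}$. With $C_{(X,Y)}(x,y)=\sum_{w}x^{|w|}y^{\mathrm{des}(w)}$, the sum being over all Catalan words $w$ (of any length $|w|\ge 0$) avoiding $(X,Y)$, one sets $D_{(X,Y)}(x)=\left.\frac{\partial C_{(X,Y)}(x,y)}{\partial y}\right|_{y=1}=\sum_w \mathrm{des}(w)\,x^{|w|}$. Identities are between formal power series in $x$ (after clearing denominators); the square root of a power series with constant term $1$ is the one with constant term $1$. -}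

module Defs where

open import Algebra.Bundles using (CommutativeRing)
open import Data.Bool.Base using (if_then_else_)
open import Data.Fin.Base using (toℕ)
open import Data.Fin.Properties using (toℕ<n; toℕ-fromℕ; toℕ-inject₁)
import Data.Integer.Base as ℤ
open import Data.List.Base using (List; []; _∷_; length; map; concatMap; filter; upTo)
open import Data.List.Membership.Propositional using (_∈_; find; lose)
open import Data.List.Membership.Propositional.Properties
  using (∈-map⁺; ∈-map⁻; ∈-concatMap⁺; ∈-concatMap⁻; ∈-upTo⁺; ∈-upTo⁻)
open import Data.List.Properties using (∷-injectiveʳ)
open import Data.List.Relation.Unary.All as All using ([])
import Data.List.Relation.Unary.All.Properties as All
open import Data.List.Relation.Unary.AllPairs as AllPairs using ([]; _∷_)
import Data.List.Relation.Unary.AllPairs.Properties as AllPairs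
open import Data.List.Relation.Unary.Any using (here; there)
open import Data.List.Relation.Unary.Linked using (Linked; [-]; _∷_)
open import Data.List.Relation.Unary.Unique.Propositional using (Unique)
open import Data.List.Relation.Unary.Unique.Propositional.Properties
  using (map⁺; concat⁺; upTo⁺)
open import Data.Nat.Base as ℕ using (ℕ; zero; suc; _∸_; _≤_; _<_; z≤n; s≤s)
open import Data.Nat.ListAction using (sum)
import Data.Nat.Properties as ℕ
open import Data.Product.Base using (_×_; _,_)
open import Data.Rational.Base using (ℚ; 0ℚ; 1ℚ; ½; _+_; _*_; _-_; _/_)
import Data.Rational.Properties as ℚ
open import Data.Rational.Solver using (module +-*-Solver)
open import Function.Base using (_∘_)
open import Level using (Level; _⊔_)
open import Relation.Binary.Core using (Rel)
open import Relation.Binary.Definitions using (Decidable)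
open import Relation.Binary.PropositionalEquality
  using (_≡_; _≢_; _≗_; refl; sym; trans; cong; cong₂; module ≡-Reasoning)
open import Relation.Nullary.Decidable using (Dec; yes; no; does; ¬?; dec-true; dec-false)
open import Relation.Nullary.Negation using (¬_)

open import Algebra.Properties.Semiring.Sum
  (CommutativeRing.semiring ℚ.+-*-commutativeRing)
  using (sum-syntax; sum-cong-≗; sum-init-last)

private
  variable
    ℓ₁ ℓ₂ : Level

------------------------------------------------------------------------
-- Catalan words

Step : Rel ℕ _
Step a b = b ≤ suc a

data IsCatalan : List ℕ → Set where
  []   : IsCatalan []
  word : ∀ {w} → Linked Step (0 ∷ w) → IsCatalan (0 ∷ w)

data Contains (X : Rel ℕ ℓ₁) (Y : Rel ℕ ℓ₂) : List ℕ → Set (ℓ₁ ⊔ ℓ₂) where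
  here  : ∀ {a b c w} → X a b → Y b c → Contains X Y (a ∷ b ∷ c ∷ w)
  there : ∀ {a w} → Contains X Y w → Contains X Y (a ∷ w)

Avoids : Rel ℕ ℓ₁ → Rel ℕ ℓ₂ → List ℕ → Set _
Avoids X Y w = ¬ Contains X Y w

module _ {X : Rel ℕ ℓ₁} {Y : Rel ℕ ℓ₂} (X? : Decidable X) (Y? : Decidable Y) where

  contains? : ∀ w → Dec (Contains X Y w)
  contains? []           = no λ ()
  contains? (_ ∷ [])     = no λ { (there ()) }
  contains? (_ ∷ _ ∷ []) = no λ { (there (there ())) }
  contains? (a ∷ b ∷ c ∷ w) with X? a b | Y? b c | contains? (b ∷ c ∷ w)
  ... | yes x | yes y | _     = yes (here x y)
  ... | _     | _     | yes p = yes (there p)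
  ... | no ¬x | _     | no ¬p = no λ { (here x _) → ¬x x ; (there p) → ¬p p }
  ... | yes _ | no ¬y | no ¬p = no λ { (here _ y) → ¬y y ; (there p) → ¬p p }

  avoids? : ∀ w → Dec (Avoids X Y w)
  avoids? w = ¬? (contains? w)

des : List ℕ → ℕ
des []          = 0
des (_ ∷ [])    = 0
des (a ∷ b ∷ w) = (if does (b ℕ.<? a) then 1 else 0) ℕ.+ des (b ∷ w)

-- The words w of length n that may follow the letter a.
continuations : ℕ → ℕ → List (List ℕ)
continuations a zero    = [] ∷ []
continuations a (suc n) =
  concatMap (λ b → map (b ∷_) (continuations b n)) (upTo (suc (suc a)))

catalanWords : ℕ → List (List ℕ)
catalanWords zero    = [] ∷ []
catalanWords (suc n) = map (0 ∷_) (continuations 0 n)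

-- catalanWords n lists the Catalan words of length n, each exactly once; see
-- catalanWords-sound, catalanWords-complete and catalanWords-unique.

private
  continuations-sound : ∀ a n {w} → w ∈ continuations a n →
                        Linked Step (a ∷ w) × length w ≡ n
  continuations-sound a zero    (here refl) = [-] , refl
  continuations-sound a (suc n) w∈
    with b , b∈ , w∈′ ← find (∈-concatMap⁻ (λ b → map (b ∷_) (continuations b n))
                                {xs = upTo (suc (suc a))} w∈)
    with v , v∈ , refl ← ∈-map⁻ (b ∷_) w∈′
    with l , e ← continuations-sound b n v∈
    = ℕ.≤-pred (∈-upTo⁻ b∈) ∷ l , cong suc e

  continuations-complete : ∀ a {w} → Linked Step (a ∷ w) →
                           w ∈ continuations a (length w)
  continuations-complete a {[]}    _       = here refl
  continuations-complete a {b ∷ w} (s ∷ l) =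
    ∈-concatMap⁺ (λ b → map (b ∷_) (continuations b (length w)))
      (lose (∈-upTo⁺ (s≤s s)) (∈-map⁺ (b ∷_) (continuations-complete b l)))

  continuations-unique : ∀ a n → Unique (continuations a n)
  continuations-unique a zero    = [] ∷ []
  continuations-unique a (suc n) = concat⁺
    (All.map⁺ (All.universal (λ b → map⁺ ∷-injectiveʳ (continuations-unique b n)) _))
    (AllPairs.map⁺ (AllPairs.map disjoint (upTo⁺ (suc (suc a)))))
    where
    disjoint : ∀ {b c} → b ≢ c → ∀ {w} →
               ¬ (w ∈ map (b ∷_) (continuations b n) × w ∈ map (c ∷_) (continuations c n))
    disjoint {b} {c} b≢c (p , q)
      with _ , _ , refl ← ∈-map⁻ (b ∷_) p
      with _ , _ , refl ← ∈-map⁻ (c ∷_) q = b≢c refl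

catalanWords-sound : ∀ n {w} → w ∈ catalanWords n → IsCatalan w × length w ≡ n
catalanWords-sound zero    (here refl) = [] , refl
catalanWords-sound (suc n) w∈
  with v , v∈ , refl ← ∈-map⁻ (0 ∷_) w∈
  with l , e ← continuations-sound 0 n v∈ = word l , cong suc e

catalanWords-complete : ∀ {w} → IsCatalan w → w ∈ catalanWords (length w)
catalanWords-complete []       = here refl
catalanWords-complete (word l) = ∈-map⁺ (0 ∷_) (continuations-complete 0 l)

catalanWords-unique : ∀ n → Unique (catalanWords n)
catalanWords-unique zero    = [] ∷ []
catalanWords-unique (suc n) = map⁺ ∷-injectiveʳ (continuations-unique 0 n)

------------------------------------------------------------------------
-- Formal power series over ℚ, as coefficient sequences.  Two series are
-- equal when they are related by _≗_.

Series : Set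
Series = ℕ → ℚ

infixl 6 _⊕_ _⊖_
infixl 7 _⊛_
infixr 8 _·_
infix  9 x^_

_⊕_ _⊖_ _⊛_ : Series → Series → Series
(f ⊕ g) n = f n + g n
(f ⊖ g) n = f n - g n
(f ⊛ g) n = ∑[ i < suc n ] (f (toℕ i) * g (n ∸ toℕ i))

fromℕℚ : ℕ → ℚ
fromℕℚ c = ℤ.+ c / 1

_·_ : ℕ → Series → Series
(c · f) n = fromℕℚ c * f n

x^_ : ℕ → Series
(x^ zero)  zero    = 1ℚ
(x^ zero)  (suc _) = 0ℚ
(x^ suc k) zero    = 0ℚ
(x^ suc k) (suc n) = (x^ k) n

1ₛ x : Series
1ₛ = x^ 0
x  = x^ 1

-- The square root of a series f with f 0 ≡ 1.  approx f n is the
-- polynomial of degree ≤ n whose square agrees with f up to degree n; the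
-- next coefficient is determined because the constant term is 1.
private
  extend : Series → ℚ → ℕ → Series
  extend f c n k = if does (k ℕ.≟ n) then c else f k

approx : Series → ℕ → Series
approx f zero    = 1ₛ
approx f (suc n) =
  extend (approx f n) (½ * (f (suc n) - (approx f n ⊛ approx f n) (suc n))) (suc n)

sqrt : Series → Series
sqrt f n = approx f n n

sqrt-constant : ∀ f → sqrt f 0 ≡ 1ℚ
sqrt-constant f = refl

private
  extend-≡ : ∀ f c n → extend f c n n ≡ c
  extend-≡ f c n = cong (if_then c else f n) (dec-true (n ℕ.≟ n) refl)

  extend-≢ : ∀ f c {n k} → k ≢ n → extend f c n k ≡ f k
  extend-≢ f c {n} {k} k≢n = cong (if_then c else f k) (dec-false (k ℕ.≟ n) k≢n)

  approx-> : ∀ f n {k} → n < k → approx f n k ≡ 0ℚ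
  approx-> f zero    {suc k} _   = refl
  approx-> f (suc n) {k}     n<k =
    trans (extend-≢ (approx f n) _ (ℕ.<⇒≢ n<k ∘ sym)) (approx-> f n (ℕ.<-trans (ℕ.n<1+n n) n<k))

  approx-≤ : ∀ f n {k} → k ≤ n → approx f n k ≡ sqrt f k
  approx-≤ f zero    z≤n = refl
  approx-≤ f (suc n) {k} k≤1+n with k ℕ.≟ suc n
  ... | yes refl = refl
  ... | no k≢1+n = trans (extend-≢ (approx f n) _ k≢1+n)
                         (approx-≤ f n (ℕ.≤-pred (ℕ.≤∧≢⇒< k≤1+n k≢1+n)))

  middle : Series → ℕ → ℚ
  middle f n = ∑[ i < n ] (f (suc (toℕ i)) * f (n ∸ toℕ i))

  square-suc : ∀ f n → (f ⊛ f) (suc n) ≡ f 0 * f (suc n) + (middle f n + f (suc n) * f 0)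
  square-suc f n = cong (f 0 * f (suc n) +_) (trans
    (sum-init-last {n} (λ i → f (suc (toℕ i)) * f (n ∸ toℕ i)))
    (cong₂ _+_
      (sum-cong-≗ {n} λ i → cong₂ (λ j k → f (suc j) * f (n ∸ k)) (toℕ-inject₁ i) (toℕ-inject₁ i))
      (cong₂ (λ j k → f (suc j) * f k) (toℕ-fromℕ n)
        (trans (cong (n ∸_) (toℕ-fromℕ n)) (ℕ.n∸n≡0 n)))))

  middle-cong : ∀ {f g} n → (∀ {k} → k ≤ n → f k ≡ g k) → middle f n ≡ middle g n
  middle-cong n f≡g = sum-cong-≗ {n} λ i →
    cong₂ _*_ (f≡g (toℕ<n i)) (f≡g (ℕ.m∸n≤m n (toℕ i)))

  approx-square : ∀ f n → (approx f n ⊛ approx f n) (suc n) ≡ middle (sqrt f) n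
  approx-square f n = trans (square-suc a n) (begin
    a 0 * a (suc n) + (middle a n + a (suc n) * a 0) ≡⟨ cong (λ z → a 0 * z + (middle a n + z * a 0)) (approx-> f n (ℕ.n<1+n n)) ⟩
    a 0 * 0ℚ + (middle a n + 0ℚ * a 0)               ≡⟨ cong₂ (λ y z → y + (middle a n + z)) (ℚ.*-zeroʳ (a 0)) (ℚ.*-zeroˡ (a 0)) ⟩
    0ℚ + (middle a n + 0ℚ)                           ≡⟨ ℚ.+-identityˡ _ ⟩
    middle a n + 0ℚ                                  ≡⟨ ℚ.+-identityʳ _ ⟩
    middle a n                                       ≡⟨ middle-cong n (approx-≤ f n) ⟩
    middle (sqrt f) n                                ∎)
    where
    open ≡-Reasoning
    a = approx f n

sqrt-square : ∀ f → f 0 ≡ 1ℚ → sqrt f ⊛ sqrt f ≗ f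
sqrt-square f f₀≡1 zero    = sym f₀≡1
sqrt-square f f₀≡1 (suc n) = begin
  (s ⊛ s) (suc n)                                  ≡⟨ square-suc s n ⟩
  1ℚ * s (suc n) + (m + s (suc n) * 1ℚ)            ≡⟨ cong (λ z → 1ℚ * z + (m + z * 1ℚ)) s≡ ⟩
  1ℚ * (½ * (f (suc n) - m)) + (m + ½ * (f (suc n) - m) * 1ℚ)
                                                   ≡⟨ solve 2 (λ p q → con 1ℚ :* (con ½ :* (p :- q)) :+ (q :+ con ½ :* (p :- q) :* con 1ℚ) := p)
                                                        refl (f (suc n)) m ⟩
  f (suc n)                                        ∎
  where
  open ≡-Reasoning
  open +-*-Solver
  s = sqrt f
  m = middle s n
  s≡ : s (suc n) ≡ ½ * (f (suc n) - m)
  s≡ = trans (extend-≡ (approx f n) _ (suc n))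
             (cong (λ z → ½ * (f (suc n) - z)) (approx-square f n))

------------------------------------------------------------------------
-- D X? Y? is the generating function of the total number of descents over
-- the Catalan words avoiding (X , Y).

totalDes : {X : Rel ℕ ℓ₁} {Y : Rel ℕ ℓ₂} → Decidable X → Decidable Y → ℕ → ℕ
totalDes X? Y? n = sum (map des (filter (avoids? X? Y?) (catalanWords n)))

D : {X : Rel ℕ ℓ₁} {Y : Rel ℕ ℓ₂} → Decidable X → Decidable Y → Series
D X? Y? n = fromℕℚ (totalDes X? Y? n)

{-# OPTIONS --safe #-}
module Submission where

-- Let F a (respectively A a) count, by length, the continuations of an avoiding
-- word that ends in a after a non-rising step (respectively in suc a after a
-- rise), and let T a and B a add up their descents.  Reading one more letter
-- gives a linear system, the same for (F , A) and (T , B) up to source terms: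
-- after a rise no smaller letter may follow, and the sums over smaller letters
-- telescope when a and suc a are compared.  Each equation determines a
-- coefficient by earlier ones, so the solution is unique.  With λ (here ratio) the
-- power series root of x λ² - (1 + x²) λ + 1 (the kernel) and √Δ = 1 + x² - 2xλ, a
-- solution is a multiple of λᵃ for F, and an affine function of a times λᵃ for
-- T; the latter is the derivative at y = 1 of F when y marks descents.
-- Finally D = x T 0.

open import Defs
open import Algebra.Bundles using (CommutativeRing)
import Algebra.Solver.Ring as RingSolver
open import Algebra.Solver.Ring.AlmostCommutativeRing
  using (fromCommutativeRing; _-Raw-AlmostCommutative⟶_; Induced-equivalence)
open import Data.Bool.Base using (true; false; if_then_else_)
open import Data.Fin.Base using (zero; suc)
import Data.Integer.Base as ℤ
import Data.Integer.Properties as ℤ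
open import Data.List.Base using (List; []; _∷_; _++_; _∷ʳ_; [_]; map; concatMap; filter; upTo)
open import Data.List.Properties using (map-cong; map-∘; map-++; upTo-∷ʳ)
open import Data.Maybe.Base using (just; nothing)
open import Data.Nat.Base using (ℕ; zero; suc; _<_; _>_; _≤_) renaming (_+_ to _+ⁿ_)
open import Data.Nat.Induction using (<-rec)
open import Data.Nat.ListAction using (sum)
open import Data.Nat.ListAction.Properties using (sum-++)
import Data.Nat.Properties as ℕ
open import Data.Nat.Properties using (_<?_; _>?_)
import Data.Nat.Solver as ℕ
open import Data.Product.Base using (_,_; _×_; proj₁; proj₂)
open import Data.Rational.Base using (ℚ; 0ℚ; 1ℚ; ½; _+_; _*_; _-_; -_; toℚᵘ; fromℚᵘ)
import Data.Rational.Properties as ℚ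
open import Data.Rational.Solver using (module +-*-Solver)
import Data.Rational.Unnormalised.Base as ℚᵘ
import Data.Rational.Unnormalised.Properties as ℚᵘ
open import Data.Vec.Base using (Vec; []; _∷_)
open import Function.Base using (_∘_)
open import Function.Bundles using (mk⇔)
open import Level using (0ℓ)
open import Relation.Binary.Definitions using (WeaklyDecidable)
open import Relation.Binary.PropositionalEquality
  using (_≡_; _≗_; refl; sym; trans; cong; cong₂; module ≡-Reasoning)
import Relation.Binary.Reasoning.Setoid as SetoidReasoning
open import Relation.Nullary.Decidable using (yes; no; does; does-⇔; dec-true; dec-false)
open import Relation.Unary using (Decidable)

-- The ring of formal power series

tail : Series → Series
tail f n = f (suc n)

const : ℚ → Series
const c zero    = c
const c (suc _) = 0ℚ

0ₛ : Series
0ₛ _ = 0ℚ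

⊝_ : Series → Series
(⊝ f) n = - f n

scale : ℚ → Series → Series
scale c f n = c * f n

⊛-cong : ∀ {f g h k} → f ≗ g → h ≗ k → f ⊛ h ≗ g ⊛ k
⊛-cong f≗g h≗k zero    = cong (_+ 0ℚ) (cong₂ _*_ (f≗g 0) (h≗k 0))
⊛-cong f≗g h≗k (suc n) =
  cong₂ _+_ (cong₂ _*_ (f≗g 0) (h≗k (suc n))) (⊛-cong (f≗g ∘ suc) h≗k n)

⊛-distribʳ : ∀ f g h → (g ⊕ h) ⊛ f ≗ g ⊛ f ⊕ h ⊛ f
⊛-distribʳ f g h zero    = solve 3 (λ a b c → (b :+ c) :* a :+ con 0ℚ := b :* a :+ con 0ℚ :+ (c :* a :+ con 0ℚ)) refl (f 0) (g 0) (h 0)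
  where open +-*-Solver
⊛-distribʳ f g h (suc n) = trans
  (cong ((g 0 + h 0) * f (suc n) +_) (⊛-distribʳ f (tail g) (tail h) n))
  (solve 5 (λ b c a p q → (b :+ c) :* a :+ (p :+ q) := b :* a :+ p :+ (c :* a :+ q)) refl
    (g 0) (h 0) (f (suc n)) ((tail g ⊛ f) n) ((tail h ⊛ f) n))
  where open +-*-Solver

scale-⊛ : ∀ c f g → scale c f ⊛ g ≗ scale c (f ⊛ g)
scale-⊛ c f g zero    = solve 3 (λ c a b → c :* a :* b :+ con 0ℚ := c :* (a :* b :+ con 0ℚ)) refl c (f 0) (g 0)
  where open +-*-Solver
scale-⊛ c f g (suc n) = trans
  (cong (c * f 0 * g (suc n) +_) (scale-⊛ c (tail f) g n))
  (solve 4 (λ c a b p → c :* a :* b :+ c :* p := c :* (a :* b :+ p)) refl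
    c (f 0) (g (suc n)) ((tail f ⊛ g) n))
  where open +-*-Solver

-- The product unfolds at index 0 of `f`; splitting off the opposite end is what the induction for
-- commutativity has to match.
⊛-sucʳ : ∀ f g n → (f ⊛ g) (suc n) ≡ f (suc n) * g 0 + (f ⊛ tail g) n
⊛-sucʳ f g zero    = solve 4 (λ a b c d → a :* b :+ (c :* d :+ con 0ℚ) := c :* d :+ (a :* b :+ con 0ℚ)) refl (f 0) (g 1) (f 1) (g 0)
  where open +-*-Solver
⊛-sucʳ f g (suc n) = trans
  (cong (f 0 * g (suc (suc n)) +_) (⊛-sucʳ (tail f) g n))
  (solve 3 (λ a b c → a :+ (b :+ c) := b :+ (a :+ c)) refl
    (f 0 * g (suc (suc n))) (f (suc (suc n)) * g 0) ((tail f ⊛ tail g) n))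
  where open +-*-Solver

⊛-comm : ∀ f g → f ⊛ g ≗ g ⊛ f
⊛-comm f g zero    = cong (_+ 0ℚ) (ℚ.*-comm (f 0) (g 0))
⊛-comm f g (suc n) = trans
  (cong₂ _+_ (ℚ.*-comm (f 0) (g (suc n))) (⊛-comm (tail f) g n))
  (sym (⊛-sucʳ g f n))

⊛-assoc : ∀ f g h → (f ⊛ g) ⊛ h ≗ f ⊛ (g ⊛ h)
⊛-assoc f g h zero    = solve 3 (λ a b c → (a :* b :+ con 0ℚ) :* c :+ con 0ℚ := a :* (b :* c :+ con 0ℚ) :+ con 0ℚ) refl (f 0) (g 0) (h 0)
  where open +-*-Solver
⊛-assoc f g h (suc n) = begin
  -- By definition `tail (f ⊛ g)` is `scale (f 0) (tail g) ⊕ tail f ⊛ g`, so distributivity applies.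
  (f 0 * g 0 + 0ℚ) * h (suc n) + ((scale (f 0) (tail g) ⊕ tail f ⊛ g) ⊛ h) n
    ≡⟨ cong ((f 0 * g 0 + 0ℚ) * h (suc n) +_) (⊛-distribʳ h (scale (f 0) (tail g)) (tail f ⊛ g) n) ⟩
  (f 0 * g 0 + 0ℚ) * h (suc n) + ((scale (f 0) (tail g) ⊛ h) n + ((tail f ⊛ g) ⊛ h) n)
    ≡⟨ cong₂ (λ p q → (f 0 * g 0 + 0ℚ) * h (suc n) + (p + q))
         (scale-⊛ (f 0) (tail g) h n) (⊛-assoc (tail f) g h n) ⟩
  (f 0 * g 0 + 0ℚ) * h (suc n) + (f 0 * (tail g ⊛ h) n + (tail f ⊛ (g ⊛ h)) n)
    ≡⟨ solve 5 (λ a b c p q → (a :* b :+ con 0ℚ) :* c :+ (a :* p :+ q) := a :* (b :* c :+ p) :+ q) refl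
         (f 0) (g 0) (h (suc n)) ((tail g ⊛ h) n) ((tail f ⊛ (g ⊛ h)) n) ⟩
  f 0 * (g ⊛ h) (suc n) + (tail f ⊛ (g ⊛ h)) n ∎
  where
  open ≡-Reasoning
  open +-*-Solver

0ₛ-⊛ : ∀ f → 0ₛ ⊛ f ≗ 0ₛ
0ₛ-⊛ f zero    = cong (_+ 0ℚ) (ℚ.*-zeroˡ (f 0))
0ₛ-⊛ f (suc n) = cong₂ _+_ (ℚ.*-zeroˡ (f (suc n))) (0ₛ-⊛ f n)

const-⊛ : ∀ c f → const c ⊛ f ≗ scale c f
const-⊛ c f zero    = ℚ.+-identityʳ (c * f 0)
const-⊛ c f (suc n) = trans (cong (c * f (suc n) +_) (0ₛ-⊛ f n)) (ℚ.+-identityʳ _)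

1ₛ≗const : 1ₛ ≗ const 1ℚ
1ₛ≗const zero    = refl
1ₛ≗const (suc _) = refl

⊛-identityˡ : ∀ f → 1ₛ ⊛ f ≗ f
⊛-identityˡ f n = trans (⊛-cong {h = f} 1ₛ≗const (λ _ → refl) n)
  (trans (const-⊛ 1ℚ f n) (ℚ.*-identityˡ (f n)))

seriesRing : CommutativeRing 0ℓ 0ℓ
seriesRing = record
  { Carrier = Series ; _≈_ = _≗_ ; _+_ = _⊕_ ; _*_ = _⊛_ ; -_ = ⊝_ ; 0# = 0ₛ ; 1# = 1ₛ
  ; isCommutativeRing = record
    { isRing = record
      { +-isAbelianGroup = record
        { isGroup = record
          { isMonoid = record
            { isSemigroup = record
              { isMagma = record
                { isEquivalence = record
                  { refl  = λ _ → refl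
                  ; sym   = λ p n → sym (p n)
                  ; trans = λ p q n → trans (p n) (q n)
                  }
                ; ∙-cong = λ p q n → cong₂ _+_ (p n) (q n)
                }
              ; assoc = λ f g h n → ℚ.+-assoc (f n) (g n) (h n)
              }
            ; identity = (λ f n → ℚ.+-identityˡ (f n)) , (λ f n → ℚ.+-identityʳ (f n))
            }
          ; inverse = (λ f n → ℚ.+-inverseˡ (f n)) , (λ f n → ℚ.+-inverseʳ (f n))
          ; ⁻¹-cong = λ p n → cong -_ (p n)
          }
        ; comm = λ f g n → ℚ.+-comm (f n) (g n)
        }
      ; *-cong     = ⊛-cong
      ; *-assoc    = ⊛-assoc
      ; *-identity = ⊛-identityˡ , λ f n → trans (⊛-comm f 1ₛ n) (⊛-identityˡ f n)
      ; distrib    = (λ f g h n → trans (⊛-comm f (g ⊕ h) n)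
                       (trans (⊛-distribʳ f g h n) (cong₂ _+_ (⊛-comm g f n) (⊛-comm h f n))))
                   , ⊛-distribʳ
      }
    ; *-comm = ⊛-comm
    }
  }

open CommutativeRing seriesRing using (setoid)
  renaming (refl to ≗-refl; sym to ≗-sym; trans to ≗-trans)

-- Gives the ring solver rational coefficients, so that identities involving ½ normalise too.
const-homo : CommutativeRing.rawRing ℚ.+-*-commutativeRing
               -Raw-AlmostCommutative⟶ fromCommutativeRing seriesRing
const-homo = record
  { ⟦_⟧    = const
  ; +-homo = λ { _ _ zero → refl ; _ _ (suc _) → refl }
  ; *-homo = λ c d n → sym (trans (const-⊛ c (const d) n) (scale-const c d n))
  ; -‿homo = λ { _ zero → refl ; _ (suc _) → refl }
  ; 0-homo = λ { zero → refl ; (suc _) → refl }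
  ; 1-homo = λ n → sym (1ₛ≗const n)
  }
  where
  scale-const : ∀ c d → scale c (const d) ≗ const (c * d)
  scale-const c d zero    = refl
  scale-const c d (suc _) = ℚ.*-zeroʳ c

coeff≟ : WeaklyDecidable (Induced-equivalence const-homo)
coeff≟ c d with c ℚ.≟ d
... | yes c≡d = just λ n → cong (λ e → const e n) c≡d
... | no _    = nothing

module Solver = RingSolver (CommutativeRing.rawRing ℚ.+-*-commutativeRing)
  (fromCommutativeRing seriesRing) const-homo coeff≟

x⊛-zero : ∀ f → (x ⊛ f) 0 ≡ 0ℚ
x⊛-zero f = trans (ℚ.+-identityʳ _) (ℚ.*-zeroˡ (f 0))

x⊛-suc : ∀ f n → (x ⊛ f) (suc n) ≡ f n
x⊛-suc f n = trans (cong₂ _+_ (ℚ.*-zeroˡ (f (suc n))) (⊛-identityˡ f n)) (ℚ.+-identityˡ (f n))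

-- Multiplication by `x` shifts by one degree, so an unknown behind a factor `x` enters only through
-- its earlier coefficients.
x⊛-cong-< : ∀ {f g} n → (∀ {m} → m < n → f m ≡ g m) → (x ⊛ f) n ≡ (x ⊛ g) n
x⊛-cong-< {f} {g} zero    f≡g = trans (x⊛-zero f) (sym (x⊛-zero g))
x⊛-cong-< {f} {g} (suc n) f≡g = trans (x⊛-suc f n) (trans (f≡g (ℕ.n<1+n n)) (sym (x⊛-suc g n)))

⊕-cong : ∀ {f g h k} → f ≗ g → h ≗ k → f ⊕ h ≗ g ⊕ k
⊕-cong f≗g h≗k n = cong₂ _+_ (f≗g n) (h≗k n)

⊖-cong : ∀ {f g h k} → f ≗ g → h ≗ k → f ⊖ h ≗ g ⊖ k
⊖-cong f≗g h≗k n = cong₂ _-_ (f≗g n) (h≗k n)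

⊛-congˡ : ∀ f {g h} → g ≗ h → f ⊛ g ≗ f ⊛ h
⊛-congˡ f = ⊛-cong {f} ≗-refl

x^-suc : ∀ k → x^ suc k ≗ x ⊛ x^ k
x^-suc k zero    = sym (x⊛-zero (x^ k))
x^-suc k (suc n) = sym (x⊛-suc (x^ k) n)

·-const : ∀ c f → c · f ≗ const (fromℕℚ c) ⊛ f
·-const c f = ≗-sym (const-⊛ (fromℕℚ c) f)

-- Serves the quadratic equation of `ratio`, which is first obtained multiplied by `x`.
x⊛-cancel : ∀ f → x ⊛ f ≗ 0ₛ → f ≗ 0ₛ
x⊛-cancel f x⊛f≗0 n = trans (sym (x⊛-suc f n)) (x⊛f≗0 (suc n))

-- Sums over continuations

∑< : ℕ → (ℕ → ℕ) → ℕ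
∑< m h = sum (map h (upTo m))

-- Splits at the top of the range, because the largest admissible next letters are the special
-- cases.
∑<-suc : ∀ m h → ∑< (suc m) h ≡ ∑< m h +ⁿ h m
∑<-suc m h = begin
  sum (map h (upTo (suc m)))           ≡⟨ cong (sum ∘ map h) (upTo-∷ʳ m) ⟨
  sum (map h (upTo m ∷ʳ m))            ≡⟨ cong sum (map-++ h (upTo m) [ m ]) ⟩
  sum (map h (upTo m) ++ [ h m ])      ≡⟨ sum-++ (map h (upTo m)) [ h m ] ⟩
  ∑< m h +ⁿ (h m +ⁿ 0)                 ≡⟨ cong (∑< m h +ⁿ_) (ℕ.+-identityʳ (h m)) ⟩
  ∑< m h +ⁿ h m                        ∎
  where open ≡-Reasoning

∑<-cong : ∀ m {h k} → (∀ {b} → b < m → h b ≡ k b) → ∑< m h ≡ ∑< m k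
∑<-cong zero    h≡k = refl
∑<-cong (suc m) {h} {k} h≡k = trans (∑<-suc m h) (trans
  (cong₂ _+ⁿ_ (∑<-cong m (λ b<m → h≡k (ℕ.m<n⇒m<1+n b<m))) (h≡k (ℕ.n<1+n m)))
  (sym (∑<-suc m k)))

∑<-zero : ∀ m → ∑< m (λ _ → 0) ≡ 0
∑<-zero zero    = refl
∑<-zero (suc m) = trans (∑<-suc m (λ _ → 0)) (trans (ℕ.+-identityʳ _) (∑<-zero m))

module _ {A : Set} where

  sum-map-+ : ∀ (g h : A → ℕ) ws →
    sum (map (λ w → g w +ⁿ h w) ws) ≡ sum (map g ws) +ⁿ sum (map h ws)
  sum-map-+ g h []       = refl
  sum-map-+ g h (w ∷ ws) = trans (cong (g w +ⁿ h w +ⁿ_) (sum-map-+ g h ws))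
    (solve 4 (λ a b c d → a :+ b :+ (c :+ d) := a :+ c :+ (b :+ d)) refl
      (g w) (h w) (sum (map g ws)) (sum (map h ws)))
    where open ℕ.+-*-Solver

  sum-map-zero : ∀ (ws : List A) → sum (map (λ _ → 0) ws) ≡ 0
  sum-map-zero []       = refl
  sum-map-zero (_ ∷ ws) = sum-map-zero ws

  sum-map-concatMap : ∀ {B : Set} (g : A → ℕ) (k : B → List A) bs →
    sum (map g (concatMap k bs)) ≡ sum (map (λ b → sum (map g (k b))) bs)
  sum-map-concatMap g k []       = refl
  sum-map-concatMap g k (b ∷ bs) = begin
    sum (map g (k b ++ concatMap k bs))                ≡⟨ cong sum (map-++ g (k b) (concatMap k bs)) ⟩
    sum (map g (k b) ++ map g (concatMap k bs))        ≡⟨ sum-++ (map g (k b)) _ ⟩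
    sum (map g (k b)) +ⁿ sum (map g (concatMap k bs))  ≡⟨ cong (sum (map g (k b)) +ⁿ_) (sum-map-concatMap g k bs) ⟩
    sum (map g (k b)) +ⁿ sum (map (λ b → sum (map g (k b))) bs) ∎
    where open ≡-Reasoning

  sum-map-filter : ∀ {P : A → Set} (P? : Decidable P) (g : A → ℕ) ws →
    sum (map g (filter P? ws)) ≡ sum (map (λ w → if does (P? w) then g w else 0) ws)
  sum-map-filter P? g []       = refl
  sum-map-filter P? g (w ∷ ws) with does (P? w)
  ... | true  = cong (g w +ⁿ_) (sum-map-filter P? g ws)
  ... | false = sum-map-filter P? g ws

total : (List ℕ → ℕ) → ℕ → ℕ → ℕ
total g a n = sum (map g (continuations a n))

total-cong : ∀ {g h} → g ≗ h → ∀ a n → total g a n ≡ total h a n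
total-cong g≗h a n = cong sum (map-cong g≗h (continuations a n))

total-suc : ∀ g a n → total g a (suc n) ≡ ∑< (suc (suc a)) (λ b → total (g ∘ (b ∷_)) b n)
total-suc g a n = trans
  (sum-map-concatMap g (λ b → map (b ∷_) (continuations b n)) (upTo (suc (suc a))))
  (cong sum (map-cong (λ b → cong sum (sym (map-∘ (continuations b n)))) (upTo (suc (suc a)))))

-- Avoidance and recurrences in the next letter

Avoiding : List ℕ → Set
Avoiding = Avoids _<_ _>_

avoiding? : Decidable Avoiding
avoiding? = avoids? _<?_ _>?_

-- Words containing the pattern get weight 0 instead of being filtered out, so that sums run over
-- all continuations and split by the next letter.
weigh : (List ℕ → ℕ) → List ℕ → ℕ
weigh g w = if does (avoiding? w) then g w else 0

-- An occurrence at the front would need a rise into `b`.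
avoiding-weakStep : ∀ {a b} w → b ≤ a → does (avoiding? (a ∷ b ∷ w)) ≡ does (avoiding? (b ∷ w))
avoiding-weakStep {a} {b} w b≤a = does-⇔ (mk⇔ (_∘ there) from)
  (avoiding? (a ∷ b ∷ w)) (avoiding? (b ∷ w))
  where
  from : Avoiding (b ∷ w) → Avoiding (a ∷ b ∷ w)
  from av (here a<b _) = ℕ.<⇒≱ a<b b≤a
  from av (there c)    = av c

-- An occurrence at the front would need a descent from `b` to `c`.
avoiding-rise : ∀ {a b c} w → b ≤ c →
  does (avoiding? (a ∷ b ∷ c ∷ w)) ≡ does (avoiding? (b ∷ c ∷ w))
avoiding-rise {a} {b} {c} w b≤c = does-⇔ (mk⇔ (_∘ there) from)
  (avoiding? (a ∷ b ∷ c ∷ w)) (avoiding? (b ∷ c ∷ w))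
  where
  from : Avoiding (b ∷ c ∷ w) → Avoiding (a ∷ b ∷ c ∷ w)
  from av (here _ c<b) = ℕ.<⇒≱ c<b b≤c
  from av (there p)    = av p

avoiding-peak : ∀ {a b c} w → a < b → c < b → does (avoiding? (a ∷ b ∷ c ∷ w)) ≡ false
avoiding-peak {a} {b} {c} w a<b c<b = dec-false (avoiding? (a ∷ b ∷ c ∷ w)) λ av → av (here a<b c<b)

-- The letters before a impose no constraint on what follows a unless the step
-- into a is a rise; hence these two states.
free rising : (List ℕ → ℕ) → ℕ → ℕ → ℕ
free   g a = total (weigh g ∘ (a ∷_)) a
rising g a = total (weigh g ∘ (a ∷_) ∘ (suc a ∷_)) (suc a)

weigh-cong : ∀ g h w w′ → does (avoiding? w) ≡ does (avoiding? w′) → g w ≡ h w′ →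
  weigh g w ≡ weigh h w′
weigh-cong g h w w′ = cong₂ (λ b k → if b then k else 0)

-- Applied to `one` and `des`: the weight `suc ∘ des` met after a descent is their sum.
free-+ : ∀ g h a n → free (λ w → g w +ⁿ h w) a n ≡ free g a n +ⁿ free h a n
free-+ g h a n = trans
  (total-cong split a n)
  (sum-map-+ (weigh g ∘ (a ∷_)) (weigh h ∘ (a ∷_)) (continuations a n))
  where
  split : ∀ w → weigh (λ w → g w +ⁿ h w) (a ∷ w) ≡ weigh g (a ∷ w) +ⁿ weigh h (a ∷ w)
  split w with does (avoiding? (a ∷ w))
  ... | true  = refl
  ... | false = refl

-- Treats counting and descents together: `g′` is the weight of the rest once a descent has been
-- read, namely `one` for `one` and `suc ∘ des` for `des`.
module Recurrence (c : ℕ) (g g′ : List ℕ → ℕ)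
  (g-single : ∀ a → g (a ∷ []) ≡ c)
  (g-weakRise : ∀ {a b} w → a ≤ b → g (a ∷ b ∷ w) ≡ g (b ∷ w))
  (g-descent  : ∀ {a b} w → b < a → g (a ∷ b ∷ w) ≡ g′ (b ∷ w))
  where

  free-zero : ∀ a → free g a 0 ≡ c
  free-zero a = trans (ℕ.+-identityʳ (g (a ∷ []))) (g-single a)

  rising-zero : ∀ a → rising g a 0 ≡ c
  rising-zero a = trans (ℕ.+-identityʳ _) (trans (g-weakRise [] (ℕ.n≤1+n a)) (g-single (suc a)))

  free-suc : ∀ a n → free g a (suc n) ≡ ∑< a (λ b → free g′ b n) +ⁿ free g a n +ⁿ rising g a n
  free-suc a n = begin
    free g a (suc n)
      ≡⟨ total-suc (weigh g ∘ (a ∷_)) a n ⟩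
    ∑< (suc (suc a)) branch
      -- The next letter is below `a`, equal to `a`, or `suc a`; the last branch is `rising g a n`
      -- by definition.
      ≡⟨ trans (∑<-suc (suc a) branch) (cong (_+ⁿ rising g a n) (∑<-suc a branch)) ⟩
    ∑< a branch +ⁿ branch a +ⁿ rising g a n
      ≡⟨ cong₂ (λ p q → p +ⁿ q +ⁿ rising g a n)
           (∑<-cong a λ {b} b<a → total-cong (λ w →
             weigh-cong g g′ (a ∷ b ∷ w) (b ∷ w) (avoiding-weakStep w (ℕ.<⇒≤ b<a)) (g-descent w b<a)) b n)
           (total-cong (λ w →
             weigh-cong g g (a ∷ a ∷ w) (a ∷ w) (avoiding-weakStep w ℕ.≤-refl) (g-weakRise w ℕ.≤-refl)) a n) ⟩
    ∑< a (λ b → free g′ b n) +ⁿ free g a n +ⁿ rising g a n ∎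
    where
    open ≡-Reasoning
    branch : ℕ → ℕ
    branch b = total (weigh g ∘ (a ∷_) ∘ (b ∷_)) b n

  rising-suc : ∀ a n → rising g a (suc n) ≡ free g (suc a) n +ⁿ rising g (suc a) n
  rising-suc a n = begin
    rising g a (suc n)
      ≡⟨ total-suc (weigh g ∘ (a ∷_) ∘ (suc a ∷_)) (suc a) n ⟩
    ∑< (suc (suc (suc a))) branch
      ≡⟨ trans (∑<-suc (suc (suc a)) branch) (cong (_+ⁿ branch (suc (suc a))) (∑<-suc (suc a) branch)) ⟩
    ∑< (suc a) branch +ⁿ branch (suc a) +ⁿ branch (suc (suc a))
      ≡⟨ cong₂ _+ⁿ_ (cong₂ _+ⁿ_ peaks level) rise ⟩
    free g (suc a) n +ⁿ rising g (suc a) n ∎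
    where
    open ≡-Reasoning
    branch : ℕ → ℕ
    branch b = total (weigh g ∘ (a ∷_) ∘ (suc a ∷_) ∘ (b ∷_)) b n
    -- A letter at most `a` would complete the pattern begun by the rise to `suc a`.
    peaks : ∑< (suc a) branch ≡ 0
    peaks = trans
      (∑<-cong (suc a) λ {b} b<1+a → trans
        (total-cong (λ w → cong (if_then g (a ∷ suc a ∷ b ∷ w) else 0)
          (avoiding-peak w (ℕ.n<1+n a) b<1+a)) b n)
        (sum-map-zero (continuations b n)))
      (∑<-zero (suc a))
    level : branch (suc a) ≡ free g (suc a) n
    level = total-cong (λ w → weigh-cong g g (a ∷ suc a ∷ suc a ∷ w) (suc a ∷ w)
      (trans (avoiding-rise {a} w ℕ.≤-refl) (avoiding-weakStep w ℕ.≤-refl))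
      (trans (g-weakRise (suc a ∷ w) (ℕ.n≤1+n a)) (g-weakRise w ℕ.≤-refl))) (suc a) n
    rise : branch (suc (suc a)) ≡ rising g (suc a) n
    rise = total-cong (λ w → weigh-cong g g (a ∷ suc a ∷ suc (suc a) ∷ w) (suc a ∷ suc (suc a) ∷ w)
      (avoiding-rise {a} w (ℕ.n≤1+n (suc a)))
      (g-weakRise (suc (suc a) ∷ w) (ℕ.n≤1+n a))) (suc (suc a)) n

  -- The difference of `free-suc` at `suc a` and at `a`: the sums over smaller letters differ by the
  -- single term at `a`. Terms are moved across to avoid subtraction in ℕ.
  free-step : ∀ a n → free g (suc a) (suc n) +ⁿ free g a n +ⁿ rising g a n
                    ≡ free g a (suc n) +ⁿ free g′ a n +ⁿ free g (suc a) n +ⁿ rising g (suc a) n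
  free-step a n = trans
    (cong (λ k → k +ⁿ free g a n +ⁿ rising g a n) (trans (free-suc (suc a) n)
      (cong (λ k → k +ⁿ free g (suc a) n +ⁿ rising g (suc a) n) (∑<-suc a (λ b → free g′ b n)))))
    (trans
      (solve 6 (λ S u f r f₁ r₁ → S :+ u :+ f₁ :+ r₁ :+ f :+ r := S :+ f :+ r :+ u :+ f₁ :+ r₁) refl
        (∑< a (λ b → free g′ b n)) (free g′ a n) (free g a n) (rising g a n)
        (free g (suc a) n) (rising g (suc a) n))
      (cong (λ k → k +ⁿ free g′ a n +ⁿ free g (suc a) n +ⁿ rising g (suc a) n) (sym (free-suc a n))))
    where open ℕ.+-*-Solver

-- The linear system of series and its unique solution

fromℕℚ-+ : ∀ m n → fromℕℚ (m +ⁿ n) ≡ fromℕℚ m + fromℕℚ n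
-- Normalised fractions do not compute on variables; unnormalised ones with denominator 1 add
-- through their numerators.
fromℕℚ-+ m n = ℚ.toℚᵘ-injective (begin
  toℚᵘ (fromℚᵘ (i (m +ⁿ n)))             ≈⟨ ℚ.toℚᵘ-fromℚᵘ (i (m +ⁿ n)) ⟩
  i (m +ⁿ n)                             ≡⟨ cong (λ k → ℚᵘ.mkℚᵘ k 0) (cong₂ ℤ._+_ (sym (ℤ.*-identityʳ (ℤ.+ m))) (sym (ℤ.*-identityʳ (ℤ.+ n)))) ⟩
  i m ℚᵘ.+ i n                           ≈⟨ ℚᵘ.+-cong (ℚ.toℚᵘ-fromℚᵘ (i m)) (ℚ.toℚᵘ-fromℚᵘ (i n)) ⟨
  toℚᵘ (fromℕℚ m) ℚᵘ.+ toℚᵘ (fromℕℚ n)   ≈⟨ ℚ.toℚᵘ-homo-+ (fromℕℚ m) (fromℕℚ n) ⟨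
  toℚᵘ (fromℕℚ m + fromℕℚ n)             ∎)
  where
  open import Relation.Binary.Reasoning.Setoid ℚᵘ.≃-setoid
  i : ℕ → ℚᵘ.ℚᵘ
  i k = ℚᵘ.mkℚᵘ (ℤ.+ k) 0

fromℕℚ-+₃ : ∀ m n k → fromℕℚ (m +ⁿ n +ⁿ k) ≡ fromℕℚ m + fromℕℚ n + fromℕℚ k
fromℕℚ-+₃ m n k = trans (fromℕℚ-+ (m +ⁿ n) k) (cong (_+ fromℕℚ k) (fromℕℚ-+ m n))

-- The sources `u₀` and `v` come from the empty continuation; `u a` is the change of weight caused
-- by a descent to `a`.
record System (u₀ v : Series) (u F A : ℕ → Series) : Set where
  field
    base : F 0 ≗ u₀ ⊕ x ⊛ (F 0 ⊕ A 0)
    step : ∀ a → F (suc a) ≗ F a ⊕ x ⊛ (F (suc a) ⊕ A (suc a) ⊖ A a ⊕ u a)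
    rise : ∀ a → A a ≗ v ⊕ x ⊛ (F (suc a) ⊕ A (suc a))

module _ {u₀ v u F A F′ A′} (S : System u₀ v u F A) (S′ : System u₀ v u F′ A′) where
  private
    module S  = System S
    module S′ = System S′

    Agree : ℕ → Set
    Agree n = ∀ a → F a n ≡ F′ a n × A a n ≡ A′ a n

    -- Strong induction on the degree, for all letters at once: `rise` passes from `a` to `suc a`,
    -- but only at a lower degree.
    agree : ∀ n → (∀ {m} → m < n → Agree m) → Agree n
    agree n ih a = F≡ a , A≡
      where
      A≡ : A a n ≡ A′ a n
      A≡ = trans (S.rise a n) (trans
        (cong (v n +_) (x⊛-cong-< n λ m<n → cong₂ _+_ (proj₁ (ih m<n (suc a))) (proj₂ (ih m<n (suc a)))))
        (sym (S′.rise a n)))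
      -- In `step` the term `F a` has no factor `x` and stays at degree `n`, hence the inner
      -- induction on the letter.
      F≡ : ∀ a → F a n ≡ F′ a n
      F≡ zero    = trans (S.base n) (trans
        (cong (u₀ n +_) (x⊛-cong-< n λ m<n → cong₂ _+_ (proj₁ (ih m<n 0)) (proj₂ (ih m<n 0))))
        (sym (S′.base n)))
      F≡ (suc a) = trans (S.step a n) (trans
        (cong₂ _+_ (F≡ a) (x⊛-cong-< n λ {m} m<n → cong (_+ u a m) (cong₂ _-_
          (cong₂ _+_ (proj₁ (ih m<n (suc a))) (proj₂ (ih m<n (suc a)))) (proj₂ (ih m<n a)))))
        (sym (S′.step a n)))

  System-unique : ∀ a → F a ≗ F′ a
  System-unique a n = proj₁ (<-rec Agree agree n a)

System-cong : ∀ {u₀ v u u′ F A} → (∀ a → u a ≗ u′ a) → System u₀ v u F A → System u₀ v u′ F A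
System-cong {F = F} {A = A} u≗u′ S = record
  { base = base
  ; step = λ a n → trans (step a n) (cong (F a n +_)
      (⊛-cong {x} (λ _ → refl) (λ m → cong (λ q → F (suc a) m + A (suc a) m - A a m + q) (u≗u′ a m)) n))
  ; rise = rise
  }
  where open System S

-- Linearity allows denominators to be cleared in the unknowns, so that no series has to be
-- inverted.
System-scale : ∀ k {u₀ v u F A} → System u₀ v u F A →
  System (k ⊛ u₀) (k ⊛ v) (λ a → k ⊛ u a) (λ a → k ⊛ F a) (λ a → k ⊛ A a)
System-scale k {u₀} {v} {u} {F} {A} S = record
  { base = λ n → trans (⊛-congˡ k base n)
      (solve 5 (λ k u x f r → k :* (u :+ x :* (f :+ r)) := k :* u :+ x :* (k :* f :+ k :* r))
        ≗-refl k u₀ x (F 0) (A 0) n)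
  ; step = λ a n → trans (⊛-congˡ k (step a) n)
      (solve 7 (λ k u x f f₁ r r₁ → k :* (f :+ x :* (f₁ :+ r₁ :- r :+ u))
          := k :* f :+ x :* (k :* f₁ :+ k :* r₁ :- k :* r :+ k :* u))
        ≗-refl k (u a) x (F a) (F (suc a)) (A a) (A (suc a)) n)
  ; rise = λ a n → trans (⊛-congˡ k (rise a) n)
      (solve 5 (λ k v x f r → k :* (v :+ x :* (f :+ r)) := k :* v :+ x :* (k :* f :+ k :* r))
        ≗-refl k v x (F (suc a)) (A (suc a)) n)
  }
  where
  open System S
  open Solver

series : (ℕ → ℕ) → Series
series s n = fromℕℚ (s n)

module RecurrenceSeries (c : ℕ) (g g′ : List ℕ → ℕ)
  (g-single : ∀ a → g (a ∷ []) ≡ c)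
  (g-weakRise : ∀ {a b} w → a ≤ b → g (a ∷ b ∷ w) ≡ g (b ∷ w))
  (g-descent  : ∀ {a b} w → b < a → g (a ∷ b ∷ w) ≡ g′ (b ∷ w))
  where

  open Recurrence c g g′ g-single g-weakRise g-descent

  system : System (const (fromℕℚ c)) (const (fromℕℚ c))
    (λ a → series (free g′ a) ⊖ series (free g a)) (series ∘ free g) (series ∘ rising g)
  system = record { base = base ; step = step ; rise = rise }
    where
    open ≡-Reasoning

    F A : ℕ → Series
    F = series ∘ free g
    A = series ∘ rising g

    initial : ∀ {k} f → k ≡ c → fromℕℚ k ≡ fromℕℚ c + (x ⊛ f) 0
    initial f refl = sym (trans (cong (fromℕℚ c +_) (x⊛-zero f)) (ℚ.+-identityʳ _))

    later : ∀ f n → f n ≡ 0ℚ + (x ⊛ f) (suc n)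
    later f n = sym (trans (ℚ.+-identityˡ _) (x⊛-suc f n))

    base : F 0 ≗ const (fromℕℚ c) ⊕ x ⊛ (F 0 ⊕ A 0)
    base zero    = initial (F 0 ⊕ A 0) (free-zero 0)
    base (suc n) = trans (cong fromℕℚ (free-suc 0 n))
      (trans (fromℕℚ-+ (free g 0 n) (rising g 0 n)) (later (F 0 ⊕ A 0) n))

    rise : ∀ a → A a ≗ const (fromℕℚ c) ⊕ x ⊛ (F (suc a) ⊕ A (suc a))
    rise a zero    = initial (F (suc a) ⊕ A (suc a)) (rising-zero a)
    rise a (suc n) = trans (cong fromℕℚ (rising-suc a n))
      (trans (fromℕℚ-+ (free g (suc a) n) (rising g (suc a) n)) (later (F (suc a) ⊕ A (suc a)) n))

    step : ∀ a → F (suc a) ≗ F a ⊕ x ⊛ (F (suc a) ⊕ A (suc a) ⊖ A a ⊕ (series (free g′ a) ⊖ F a))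
    step a zero    = trans (initial δ (free-zero (suc a)))
      (cong (λ k → fromℕℚ k + (x ⊛ δ) 0) (sym (free-zero a)))
      where δ = F (suc a) ⊕ A (suc a) ⊖ A a ⊕ (series (free g′ a) ⊖ F a)
    step a (suc n) = begin
      f₁⁺                                   ≡⟨ solve 3 (λ f₁⁺ f r → f₁⁺ := f₁⁺ :+ f :+ r :- f :- r) refl f₁⁺ f r ⟩
      f₁⁺ + f + r - f - r                   ≡⟨ cong (λ q → q - f - r) telescoped ⟩
      f⁺ + f′ + f₁ + r₁ - f - r             ≡⟨ solve 6 (λ f⁺ f′ f₁ r₁ f r → f⁺ :+ f′ :+ f₁ :+ r₁ :- f :- r := f⁺ :+ (f₁ :+ r₁ :- r :+ (f′ :- f))) refl f⁺ f′ f₁ r₁ f r ⟩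
      f⁺ + (f₁ + r₁ - r + (f′ - f))         ≡⟨ cong (f⁺ +_) (x⊛-suc (F (suc a) ⊕ A (suc a) ⊖ A a ⊕ (series (free g′ a) ⊖ F a)) n) ⟨
      _                                     ∎
      where
      open +-*-Solver
      f = F a n ; r = A a n ; f₁ = F (suc a) n ; r₁ = A (suc a) n
      f⁺ = F a (suc n) ; f₁⁺ = F (suc a) (suc n) ; f′ = series (free g′ a) n
      telescoped : f₁⁺ + f + r ≡ f⁺ + f′ + f₁ + r₁
      telescoped = trans (sym (fromℕℚ-+₃ (free g (suc a) (suc n)) (free g a n) (rising g a n)))
        (trans (cong fromℕℚ (free-step a n)) (trans
          (fromℕℚ-+ (free g a (suc n) +ⁿ free g′ a n +ⁿ free g (suc a) n) (rising g (suc a) n))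
          (cong (_+ r₁) (fromℕℚ-+₃ (free g a (suc n)) (free g′ a n) (free g (suc a) n)))))

-- The series of counts and of descents

one : List ℕ → ℕ
one _ = 1

des-weakRise : ∀ {a b} w → a ≤ b → des (a ∷ b ∷ w) ≡ des (b ∷ w)
des-weakRise {a} {b} w a≤b = cong (λ p → (if p then 1 else 0) +ⁿ des (b ∷ w))
  (dec-false (b <? a) (ℕ.≤⇒≯ a≤b))

des-descent : ∀ {a b} w → b < a → des (a ∷ b ∷ w) ≡ suc (des (b ∷ w))
des-descent {a} {b} w b<a = cong (λ p → (if p then 1 else 0) +ⁿ des (b ∷ w))
  (dec-true (b <? a) b<a)

counts descents : ℕ → Series
counts   a = series (free one a)
descents a = series (free des a)

counts-system : System (const 1ℚ) (const 1ℚ) (λ _ → const 0ℚ) counts (series ∘ rising one)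
counts-system = System-cong
  (λ { a zero → ℚ.+-inverseʳ (counts a 0) ; a (suc n) → ℚ.+-inverseʳ (counts a (suc n)) })
  (RecurrenceSeries.system 1 one one (λ _ → refl) (λ _ _ → refl) (λ _ _ → refl))

-- A descent adds 1 for each continuation that follows it, so the source is the counting series.
descents-system : System (const 0ℚ) (const 0ℚ) counts descents (series ∘ rising des)
descents-system = System-cong
  (λ a n → trans (cong (_- descents a n)
             (trans (cong fromℕℚ (free-+ one des a n)) (fromℕℚ-+ (free one a n) (free des a n))))
           (solve 2 (λ p q → p :+ q :- q := p) refl (counts a n) (descents a n)))
  (RecurrenceSeries.system 0 des (suc ∘ des) (λ _ → refl) des-weakRise des-descent)
  where open +-*-Solver

-- A nonempty Catalan word is the letter 0, not entered by a rise, followed by a continuation; the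
-- factor `x` accounts for that letter.
D-descents : D _<?_ _>?_ ≗ x ⊛ descents 0
D-descents zero    = sym (x⊛-zero (descents 0))
D-descents (suc n) = trans
  (cong fromℕℚ (trans (sum-map-filter avoiding? des (map (0 ∷_) (continuations 0 n)))
    (cong sum (sym (map-∘ (continuations 0 n))))))
  (sym (x⊛-suc (descents 0) n))

-- Closed forms

open Solver

Δ √Δ : Series
Δ  = 1ₛ ⊖ 4 · x ⊕ 2 · x^ 2 ⊕ x^ 4
√Δ = sqrt Δ

-- The root (1 + x² - √Δ) / (2x) of the kernel; `tail` performs the division by `x`.
ratio : Series
ratio = tail (const ½ ⊛ (const 1ℚ ⊕ x ⊛ x ⊖ √Δ))

x⊛ratio : x ⊛ ratio ≗ const ½ ⊛ (const 1ℚ ⊕ x ⊛ x ⊖ √Δ)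
-- `√Δ` has constant term 1, so the right side vanishes here and `tail` has dropped nothing.
x⊛ratio zero    = refl
x⊛ratio (suc n) = x⊛-suc ratio n

2ℚ 3ℚ 4ℚ : ℚ
2ℚ = fromℕℚ 2
3ℚ = fromℕℚ 3
4ℚ = fromℕℚ 4

-- `powers` and `naturals` recurse so that passing from `a` to `suc a` is, definitionally, the
-- substitution of `L :* P` for `P` and `𝟏 :+ I` for `I`.
powers : ℕ → Series
powers zero    = const 1ℚ
powers (suc a) = ratio ⊛ powers a

naturals : ℕ → Series
naturals zero    = const 0ℚ
naturals (suc a) = const 1ℚ ⊕ naturals a

Poly : Set
Poly = Polynomial 4

X L P I 𝟏 : Poly
X = var zero
L = var (suc zero)
P = var (suc (suc zero))
I = var (suc (suc (suc zero)))
𝟏 = con 1ℚ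

-- P and I stand for λᵃ and a.
env : ℕ → Vec Series 4
env a = x ∷ ratio ∷ powers a ∷ naturals a ∷ []

kernel σᵖ Δᵖ : Poly
kernel = X :* L :* L :- (𝟏 :+ X :* X) :* L :+ 𝟏
σᵖ = 𝟏 :+ X :* X :- con 2ℚ :* X :* L
Δᵖ = 𝟏 :- con 4ℚ :* X :+ con 2ℚ :* X :* X :+ X :* X :* X :* X

-- Makes the square root a polynomial in `x` and `ratio`, leaving the kernel as the only relation to
-- reduce by.
σ≗√Δ : ⟦ σᵖ ⟧ (env 0) ≗ √Δ
σ≗√Δ = begin
  ⟦ σᵖ ⟧ (env 0)
    ≈⟨ solve 2 (λ x l → con 1ℚ :+ x :* x :- con 2ℚ :* x :* l := con 1ℚ :+ x :* x :- con 2ℚ :* (x :* l)) ≗-refl x ratio ⟩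
  const 1ℚ ⊕ x ⊛ x ⊖ const 2ℚ ⊛ (x ⊛ ratio)
    ≈⟨ ⊖-cong {const 1ℚ ⊕ x ⊛ x} ≗-refl (⊛-congˡ (const 2ℚ) x⊛ratio) ⟩
  const 1ℚ ⊕ x ⊛ x ⊖ const 2ℚ ⊛ (const ½ ⊛ (const 1ℚ ⊕ x ⊛ x ⊖ √Δ))
    ≈⟨ solve 2 (λ x s → con 1ℚ :+ x :* x :- con 2ℚ :* (con ½ :* (con 1ℚ :+ x :* x :- s)) := s) ≗-refl x √Δ ⟩
  √Δ ∎
  where open SetoidReasoning setoid

Δ≗ : Δ ≗ ⟦ Δᵖ ⟧ (env 0)
Δ≗ = begin
  1ₛ ⊖ 4 · x ⊕ 2 · x^ 2 ⊕ x^ 4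
    ≈⟨ ⊕-cong (⊕-cong (⊖-cong 1ₛ≗const (·-const 4 x))
         (≗-trans (·-const 2 (x^ 2)) (⊛-congˡ (const 2ℚ) (x^-suc 1))))
         (≗-trans (x^-suc 3) (⊛-congˡ x (≗-trans (x^-suc 2) (⊛-congˡ x (x^-suc 1))))) ⟩
  const 1ℚ ⊖ const 4ℚ ⊛ x ⊕ const 2ℚ ⊛ (x ⊛ x) ⊕ x ⊛ (x ⊛ (x ⊛ x))
    ≈⟨ solve 1 (λ x → con 1ℚ :- con 4ℚ :* x :+ con 2ℚ :* (x :* x) :+ x :* (x :* (x :* x))
         := con 1ℚ :- con 4ℚ :* x :+ con 2ℚ :* x :* x :+ x :* x :* x :* x) ≗-refl x ⟩
  ⟦ Δᵖ ⟧ (env 0) ∎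
  where open SetoidReasoning setoid

-- Completing the square: Δ = (1 + x²)² - 4x is the discriminant of the kernel in λ, and σ² - Δ is
-- 4x times the kernel.
kernel≗0 : ∀ a → ⟦ kernel ⟧ (env a) ≗ 0ₛ
kernel≗0 a = x⊛-cancel _ (begin
  ⟦ X :* kernel ⟧ (env a)
    ≈⟨ prove (env a) (X :* kernel) (con (½ * ½) :* (σᵖ :* σᵖ :- Δᵖ)) ≗-refl ⟩
  const (½ * ½) ⊛ (⟦ σᵖ ⟧ (env a) ⊛ ⟦ σᵖ ⟧ (env a) ⊖ ⟦ Δᵖ ⟧ (env a))
    ≈⟨ ⊛-congˡ (const (½ * ½)) (⊖-cong (⊛-cong σ≗√Δ σ≗√Δ) (≗-sym Δ≗)) ⟩
  const (½ * ½) ⊛ (√Δ ⊛ √Δ ⊖ Δ)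
    ≈⟨ ⊛-congˡ (const (½ * ½)) (⊖-cong {h = Δ} (sqrt-square Δ refl) ≗-refl) ⟩
  const (½ * ½) ⊛ (Δ ⊖ Δ)
    ≈⟨ solve 2 (λ c d → c :* (d :- d) := con 0ℚ) ≗-refl (const (½ * ½)) Δ ⟩
  const 0ℚ
    ≈⟨ (λ { zero → refl ; (suc _) → refl }) ⟩
  0ₛ ∎)
  where open SetoidReasoning setoid

-- The cofactors e passed to mod-kernel are the quotients of p - q by kernel.
mod-kernel : ∀ a p q e → ⟦ p ⟧↓ (env a) ≗ ⟦ q :+ e :* kernel ⟧↓ (env a) → ⟦ p ⟧ (env a) ≗ ⟦ q ⟧ (env a)
mod-kernel a p q e p≗ = begin
  ⟦ p ⟧ (env a)                                    ≈⟨ prove (env a) p (q :+ e :* kernel) p≗ ⟩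
  ⟦ q ⟧ (env a) ⊕ ⟦ e ⟧ (env a) ⊛ ⟦ kernel ⟧ (env a) ≈⟨ ⊕-cong {⟦ q ⟧ (env a)} ≗-refl (⊛-congˡ (⟦ e ⟧ (env a)) (kernel≗0 a)) ⟩
  ⟦ q ⟧ (env a) ⊕ ⟦ e ⟧ (env a) ⊛ 0ₛ                ≈⟨ ⊕-cong {⟦ q ⟧ (env a)} ≗-refl (CommutativeRing.zeroʳ seriesRing (⟦ e ⟧ (env a))) ⟩
  ⟦ q ⟧ (env a) ⊕ 0ₛ                                ≈⟨ CommutativeRing.+-identityʳ seriesRing (⟦ q ⟧ (env a)) ⟩
  ⟦ q ⟧ (env a) ∎
  where open SetoidReasoning setoid

-- With y marking descents, x (1 - x) F a = (λ - 1) λᵃ / y and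
-- x (1 - x) A a = x + ((λ - 1) / y - x) λᵃ⁺¹, where now
-- x λ² - (1 + x² y) λ + 1 - x + x y = 0, whence √Δ λ′ = x (1 - x λ) =: U at y = 1.
-- Tᵖ and Bᵖ are the y-derivatives of these at y = 1, times √Δ; the kernel
-- relation also gives (λ - 1) / λ = x λ - x², which avoids the power λᵃ⁻¹.
Kᵖ Uᵖ : Poly
Kᵖ = X :* (𝟏 :- X)
Uᵖ = X :* (𝟏 :- X :* L)

Fᵖ Aᵖ : Poly → Poly
Fᵖ p = (L :- 𝟏) :* p
Aᵖ p = X :+ (L :- 𝟏 :- X) :* (L :* p)

Tᵖ Bᵖ : Poly → Poly → Poly
Tᵖ p i = p :* (Uᵖ :* (𝟏 :+ i :* (X :* L :- X :* X)) :- (L :- 𝟏) :* σᵖ)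
Bᵖ p i = p :* ((Uᵖ :- (L :- 𝟏) :* σᵖ) :* L :+ (L :- 𝟏 :- X) :* (𝟏 :+ i) :* Uᵖ)

K σ : Series
K = ⟦ Kᵖ ⟧ (env 0)
σ = ⟦ σᵖ ⟧ (env 0)

countsForm : System (K ⊛ const 1ℚ) (K ⊛ const 1ℚ) (λ _ → K ⊛ const 0ℚ)
  (λ a → ⟦ Fᵖ P ⟧ (env a)) (λ a → ⟦ Aᵖ P ⟧ (env a))
countsForm = record
  { base = mod-kernel 0 (Fᵖ 𝟏) (Kᵖ :* 𝟏 :+ X :* (Fᵖ 𝟏 :+ Aᵖ 𝟏)) (:- 𝟏) ≗-refl
  ; step = λ a → mod-kernel a (Fᵖ (L :* P))
      (Fᵖ P :+ X :* (Fᵖ (L :* P) :+ Aᵖ (L :* P) :- Aᵖ P :+ Kᵖ :* con 0ℚ)) ((𝟏 :- L) :* P) ≗-refl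
  ; rise = λ a → mod-kernel a (Aᵖ P)
      (Kᵖ :* 𝟏 :+ X :* (Fᵖ (L :* P) :+ Aᵖ (L :* P))) (:- (L :* P)) ≗-refl
  }

counts-closed : ∀ a → K ⊛ counts a ≗ ⟦ Fᵖ P ⟧ (env a)
counts-closed = System-unique (System-scale K counts-system) countsForm

-- The unknowns carry the extra factor `σ`, so the source is `σ` times the closed form of
-- `K ⊛ counts a`.
descentsForm : System (σ ⊛ K ⊛ const 0ℚ) (σ ⊛ K ⊛ const 0ℚ) (λ a → σ ⊛ ⟦ Fᵖ P ⟧ (env a))
  (λ a → ⟦ Tᵖ P I ⟧ (env a)) (λ a → ⟦ Bᵖ P I ⟧ (env a))
descentsForm = record
  { base = mod-kernel 0 (Tᵖ 𝟏 o)
      (σᵖ :* Kᵖ :* o :+ X :* (Tᵖ 𝟏 o :+ Bᵖ 𝟏 o)) σᵖ ≗-refl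
  ; step = λ a → mod-kernel a (Tᵖ (L :* P) I⁺)
      (Tᵖ P I :+ X :* (Tᵖ (L :* P) I⁺ :+ Bᵖ (L :* P) I⁺ :- Bᵖ P I :+ σᵖ :* Fᵖ P))
      (P :* (L :- 𝟏 :+ con 2ℚ :* X :* L :* (𝟏 :- L) :- con 2ℚ :* X :* X
        :+ X :* X :* L :+ X :* X :* X :* L :+ I :* X :* X :* (X :* L :- 𝟏))) ≗-refl
  ; rise = λ a → mod-kernel a (Bᵖ P I)
      (σᵖ :* Kᵖ :* o :+ X :* (Tᵖ (L :* P) I⁺ :+ Bᵖ (L :* P) I⁺))
      (P :* (L :- con 2ℚ :* X :* L :* L :+ X :* X :* L
        :+ (𝟏 :+ I) :* X :* (𝟏 :+ X) :* (X :* L :- 𝟏))) ≗-refl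
  }
  where
  o I⁺ : Poly
  o  = con 0ℚ
  I⁺ = 𝟏 :+ I

descents-closed : ∀ a → (σ ⊛ K) ⊛ descents a ≗ ⟦ Tᵖ P I ⟧ (env a)
descents-closed = System-unique
  (System-cong (λ a → ≗-trans (CommutativeRing.*-assoc seriesRing σ K (counts a))
                            (⊛-congˡ σ (counts-closed a)))
    (System-scale (σ ⊛ K) descents-system))
  descentsForm

corollary3p9 : let √Δ = sqrt (1ₛ ⊖ 4 · x ⊕ 2 · x^ 2 ⊕ x^ 4) in
    2 · (1ₛ ⊖ x) ⊛ x ⊛ √Δ ⊛ D _<?_ _>?_
    ≗ 1ₛ ⊖ 4 · x ⊕ 3 · x^ 2 ⊖ (1ₛ ⊖ 2 · x) ⊛ √Δ
corollary3p9 = begin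
  2 · (1ₛ ⊖ x) ⊛ x ⊛ √Δ ⊛ D _<?_ _>?_
    ≈⟨ ⊛-cong (⊛-cong (⊛-cong {h = x} (≗-trans (·-const 2 (1ₛ ⊖ x))
         (⊛-congˡ (const 2ℚ) (⊖-cong {h = x} 1ₛ≗const ≗-refl))) ≗-refl) (≗-sym σ≗√Δ)) D-descents ⟩
  const 2ℚ ⊛ (const 1ℚ ⊖ x) ⊛ x ⊛ σ ⊛ (x ⊛ descents 0)
    -- The factor `x` from `D-descents` joins `1 - x` to form `K`; the other `x` stays with 2, as
    -- 2xλ = 1 + x² - σ will be used.
    ≈⟨ solve 3 (λ x s t → con 2ℚ :* (con 1ℚ :- x) :* x :* s :* (x :* t)
         := con 2ℚ :* x :* (s :* (x :* (con 1ℚ :- x)) :* t)) ≗-refl x σ (descents 0) ⟩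
  const 2ℚ ⊛ x ⊛ (σ ⊛ K ⊛ descents 0)
    ≈⟨ ⊛-congˡ (const 2ℚ ⊛ x) (descents-closed 0) ⟩
  ⟦ con 2ℚ :* X :* Tᵖ 𝟏 (con 0ℚ) ⟧ (env 0)
    -- Eliminating 2xλ leaves σ² as the only square of σ, and σ² = Δ + 4x `kernel` gives the
    -- cofactor 4x.
    ≈⟨ mod-kernel 0 (con 2ℚ :* X :* Tᵖ 𝟏 (con 0ℚ))
         (𝟏 :- con 4ℚ :* X :+ con 3ℚ :* (X :* X) :- (𝟏 :- con 2ℚ :* X) :* σᵖ) (con 4ℚ :* X) ≗-refl ⟩
  const 1ℚ ⊖ const 4ℚ ⊛ x ⊕ const 3ℚ ⊛ (x ⊛ x) ⊖ (const 1ℚ ⊖ const 2ℚ ⊛ x) ⊛ σ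
    ≈⟨ ⊖-cong (⊕-cong (⊖-cong 1ₛ≗const (·-const 4 x))
         (≗-trans (·-const 3 (x^ 2)) (⊛-congˡ (const 3ℚ) (x^-suc 1))))
         (⊛-cong (⊖-cong 1ₛ≗const (·-const 2 x)) (≗-sym σ≗√Δ)) ⟨
  1ₛ ⊖ 4 · x ⊕ 3 · x^ 2 ⊖ (1ₛ ⊖ 2 · x) ⊛ √Δ ∎
  where open SetoidReasoning setoid
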